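{- Let $\mathcal{P}=(Q,T)$ be a parameterized system with initial configurations $Init$ and let $C_F\subseteq Q^*$. Let $\mathbb{S}$ be a symbolic representation satisfying requirements (1)--(6) of the context, and consider the refinement loop of the context (started with any relaxation operator in $\square_{\mathbb{S}}$). Then: each iteration of the refinement loop terminates. If the loop returns $\mathtt{unreachable}$, then $Init \xrightarrow{*} C_F$ does not hold. If it returns $(\mathtt{reachable},\tau)$, then $Init\xrightarrow{*}C_F$ via the transitions in $\tau$. In addition, no trace is generated twice (i.e. no trace is returned by Algorithm 1 in two different iterations of the loop).
   Context: **Parameterized systems.** A parameterized system is a pair $\mathcal{P}=(Q,T)$ with $Q$ a finite set of local states and $T$ a finite set of transitions. A transition is either local, of the form $q\to q'$, or global, of the form $q\to q':\mathbb{Q}P$ with $\mathbb{Q}\in\{\exists_L,\exists_R,\exists_{LR},\forall_L,\forall_R,\forall_{LR}\}$ and $P\subseteq Q$. Configurations are the words $C=Q^*$. For a word $w$, $w^\bullet$ is the set of letters occurring in $w$. For $c=c_1qc_2$, $c'=c_1q'c_2$, write $c\longrightarrow_t c'$ if $t$ is local $q\to q'$, or $t$ is $q\to q':\mathbb{Q}P$ and the corresponding condition holds: $\exists_L$: $c_1^\bullet\cap P\ne\emptyset$; $\exists_R$: $c_2^\bullet\cap P\neq\emptyset$; $\exists_{LR}$: $(c_1^\bullet\cup c_2^\bullet)\cap P\ne\emptyset$; $\forall_L$: $c_1^\bullet\subseteq P$; $\forall_R$: $c_2^\bullet\subseteq P$; $\forall_{LR}$: $c_1^\bullet\cup c_2^\bullet\subseteq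 P$. Let $\longrightarrow=\bigcup_{t\in T}\longrightarrow_t$, with reflexive transitive closure $\xrightarrow{*}$. $Init$ is the set of configurations of the form $p_{init}\cdots p_{init}$ for a fixed initial state $p_{init}\in Q$. $Init\xrightarrow{*}C_F$ means $c\xrightarrow{*}c'$ for some $c\in Init$, $c'\in C_F$; it holds via transitions $t_1,\dots,t_m$ if there are $c_0\in Init$, $c_m\in C_F$ and $c_1,\dots,c_{m-1}$ with $c_i\longrightarrow_{t_{i+1}}c_{i+1}$ for $0\le i<m$. **Symbolic representation.** $\mathbb{S}$ is a set, each $e\in\mathbb{S}$ denoting a nonempty set $[\![e]\!]\subseteq C$; $[\![\{e_1,\dots,e_n\}]\!]=\bigcup_i[\![e_i]\!]$. Requirements: (1) There is a decidable reflexive and transitive relation $\sqsubseteq_{\mathbb{S}}$ on $\mathbb{S}$ such that $e\sqsubseteq_{\mathbb{S}}e'$ implies $[\![e']\!]\subseteq[\![e]\!]$. For finite sets, $E\sqsubseteq_{\mathbb{S}}E'$ means that for each $e'\in E'$ there is $e\in E$ with $e\sqsubseteq_{\mathbb{S}}e'$. (2) One can compute a finite set $e\sqcap_{\mathbb{S}}e'\subseteq\mathbb{S}$ with $[\![e\sqcap_{\mathbb{S}}e']\!]=[\![e]\!]\cap[\![e']\!]$. For finite sets, $E\sqcap_{\mathbb{S}}E'=\bigcup_{e\in E,e'\in E'}e\sqcap_{\mathbb{S}}e'$. (3) $\square_{\mathbb{S}}$ is a set of computable relaxation operators $\nabla:\mathbb{S}\to\mathbb{S}$, each satisfying: (a)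 $\nabla(e)\sqsubseteq_{\mathbb{S}}e$ for all $e$; (b) $e\sqsubseteq_{\mathbb{S}}e'$ implies $\nabla(e)\sqsubseteq_{\mathbb{S}}\nabla(e')$; (c) $(\{\nabla(e)\mid e\in\mathbb{S}\},\sqsubseteq_{\mathbb{S}})$ is a well quasi ordering, i.e. there is no infinite sequence $e_1,e_2,\dots$ of its elements with $e_i\not\sqsubseteq_{\mathbb{S}}e_j$ for all $i<j$. Write $\nabla(\{e_1,\dots,e_n\})=\{\nabla(e_1),\dots,\nabla(e_n)\}$. $\nabla'$ is stronger than $\nabla$ if $\nabla(e)\sqsubseteq_{\mathbb{S}}\nabla'(e)$ for each $e\in\mathbb{S}$. (4) $\Xi$ is a computable separation operator: for finite $E,E'\subseteq\mathbb{S}$ and $\nabla\in\square_{\mathbb{S}}$ with $E\sqcap_{\mathbb{S}}E'=\emptyset$ and $\nabla(E)\sqcap_{\mathbb{S}}E'\neq\emptyset$, $\Xi(E,E',\nabla)$ returns a $\nabla'\in\square_{\mathbb{S}}$ stronger than $\nabla$ with $\nabla'(E)\sqcap_{\mathbb{S}}E'=\emptyset$. (5) There are finite $E_{Init},E_{C_F}\subseteq\mathbb{S}$ with $[\![E_{Init}]\!]=Init$ and $[\![E_{C_F}]\!]=C_F$. $E_{Init}$ is assumed minimal (no two distinct elements related by $\sqsubseteq_{\mathbb{S}}$). (6) For each $t\in T$, $e\in\mathbb{S}$: (a) one can compute finite sets $\mathrm{post}_t(e),\mathrm{pre}_t(e)\subseteq\mathbb{S}$ with $[\![\mathrm{post}_t(e)]\!]=\{c'\mid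 c\longrightarrow_tc',\,c\in[\![e]\!]\}$ and $[\![\mathrm{pre}_t(e)]\!]=\{c'\mid c'\longrightarrow_tc,\,c\in[\![e]\!]\}$; (b) $e\sqsubseteq_{\mathbb{S}}e'$ implies $\mathrm{post}_t(e)\sqsubseteq_{\mathbb{S}}\mathrm{post}_t(e')$ and $\mathrm{pre}_t(e)\sqsubseteq_{\mathbb{S}}\mathrm{pre}_t(e')$. **Traces.** A $\nabla$-trace is a sequence $e_0\cdot t_1\cdot e_1\cdots t_m\cdot e_m$ with $e_i\in\mathbb{S}$, $t_i\in T$, $e_0\in E_{Init}$ and $e_{i+1}\in\nabla(\mathrm{post}_{t_{i+1}}(e_i))$ for $0\le i<m$. **Algorithm 1** (input $\nabla$). Set $\mathcal{W}:=\{(e,e)\mid e\in E_{Init}\}$, $\mathcal{V}:=\emptyset$. While $\mathcal{W}\ne\emptyset$: pick and remove some $(e_c,\tau)$ from $\mathcal{W}$; if $\{e_c\}\sqcap_{\mathbb{S}}E_{C_F}\neq\emptyset$ return $\tau$; add $(e_c,\tau)$ to $\mathcal{V}$; for each $t\in T$ and each $e\in\{\nabla(e')\mid e'\in\mathrm{post}_t(e_c)\}$: if $e_{old}\not\sqsubseteq_{\mathbb{S}}e$ for all $(e_{old},\tau_{old})\in\mathcal{W}\cup\mathcal{V}$, then remove from $\mathcal{V}$ and from $\mathcal{W}$ all pairs $(e_{old},\tau_{old})$ with $e\sqsubseteq_{\mathbb{S}}e_{old}$ and add $(e,\tau\cdot t\cdot e)$ to $\mathcal{W}$. When $\mathcal{W}=\emptyset$,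 return $\mathtt{unreachable}$. **Algorithm 2** (input: a $\nabla$-trace $\tau=e_0\cdot t_1\cdots e_m$ with $\{e_m\}\sqcap_{\mathbb{S}}E_{C_F}\ne\emptyset$). Set $Current:=\{e_m\}\sqcap_{\mathbb{S}}E_{C_F}$. For $i=m-1$ down to $0$: let $Pred:=(\bigcup_{e\in Current}\mathrm{pre}_{t_{i+1}}(e))\sqcap_{\mathbb{S}}\{e_i\}$; if $Pred=\emptyset$ return $\Xi(\mathrm{post}_{t_{i+1}}(e_i),Current,\nabla)$, else set $Current:=Pred$. After the loop, if $Current\sqcap_{\mathbb{S}}E_{Init}\ne\emptyset$ return $(\mathtt{reachable},\tau)$, else return $\Xi(\{e_0\},E_{Init},\nabla)$. **Refinement loop.** Maintain a current relaxation $\nabla\in\square_{\mathbb{S}}$. In each iteration run Algorithm 1 with $\nabla$. If it returns $\mathtt{unreachable}$, return $\mathtt{unreachable}$. Otherwise it returns a trace $\tau$ (this trace is said to be generated in this iteration); run Algorithm 2 on $\tau$. If it returns $(\mathtt{reachable},\tau)$, return $(\mathtt{reachable},\tau)$; otherwise it returns a relaxation operator, which becomes the current relaxation for the next iteration. -}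

module Defs where

open import Data.Fin.Base using (Fin)
open import Data.Fin.Subset using (Subset; ⁅_⁆; ⋃; Nonempty; _∩_; _∪_; _⊆_)
open import Data.List.Base using (List; []; _∷_; _++_; _∷ʳ_; map; concatMap; filter; replicate; [_])
open import Data.List.Membership.Propositional using (_∈_)
open import Data.List.Relation.Unary.All using (All)
open import Data.List.Relation.Unary.Any using (Any; _─_)
open import Data.Nat.Base using (ℕ; zero; suc; _<_)
open import Data.Product.Base using (_×_; _,_; proj₁; ∃; ∃-syntax; ∃₂)
open import Data.Sum.Base using (_⊎_)
open import Level using (0ℓ)
open import Relation.Binary.Construct.Closure.ReflexiveTransitive using (Star)
open import Relation.Binary.Core using (Rel)
open import Relation.Binary.Definitions using (Decidable; Reflexive; Transitive)
open import Relation.Binary.PropositionalEquality.Core using (_≡_; _≢_)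
open import Relation.Nullary.Decidable.Core using (¬?)
open import Relation.Nullary.Negation.Core using (¬_)
open import Relation.Unary using (Pred; _≐_) renaming (_⊆_ to _⊆′_; _∩_ to _∩′_)

------------------------------------------------------------------------
-- Parameterized systems

data Quantifier : Set where
  ∃L ∃R ∃LR ∀L ∀R ∀LR : Quantifier

data Transition (n : ℕ) : Set where
  local  : (q q′ : Fin n) → Transition n
  global : (q q′ : Fin n) → Quantifier → Subset n → Transition n

_• : ∀ {n} → List (Fin n) → Subset n
w • = ⋃ (map ⁅_⁆ w)

Holds : ∀ {n} → Quantifier → Subset n → (c₁ c₂ : List (Fin n)) → Set
Holds ∃L  P c₁ c₂ = Nonempty ((c₁ •) ∩ P)
Holds ∃R  P c₁ c₂ = Nonempty ((c₂ •) ∩ P)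
Holds ∃LR P c₁ c₂ = Nonempty (((c₁ •) ∪ (c₂ •)) ∩ P)
Holds ∀L  P c₁ c₂ = (c₁ •) ⊆ P
Holds ∀R  P c₁ c₂ = (c₂ •) ⊆ P
Holds ∀LR P c₁ c₂ = ((c₁ •) ∪ (c₂ •)) ⊆ P

data _⟶[_]_ {n : ℕ} : List (Fin n) → Transition n → List (Fin n) → Set where
  local  : ∀ {q q′} c₁ c₂ →
           (c₁ ++ q ∷ c₂) ⟶[ local q q′ ] (c₁ ++ q′ ∷ c₂)
  global : ∀ {q q′ 𝒬 P} c₁ c₂ → Holds 𝒬 P c₁ c₂ →
           (c₁ ++ q ∷ c₂) ⟶[ global q q′ 𝒬 P ] (c₁ ++ q′ ∷ c₂)

record ParameterizedSystem : Set where
  field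
    ∣Q∣    : ℕ
    T      : List (Transition ∣Q∣)
    p-init : Fin ∣Q∣

  Q : Set
  Q = Fin ∣Q∣

  Trans : Set
  Trans = Transition ∣Q∣

  Config : Set
  Config = List Q

  Init : Pred Config 0ℓ
  Init c = ∃[ n ] c ≡ replicate n p-init

  _⟶_ : Rel Config 0ℓ
  c ⟶ c′ = ∃[ t ] (t ∈ T × c ⟶[ t ] c′)

  _⟶*_ : Rel Config 0ℓ
  _⟶*_ = Star _⟶_

  data _⟶*[_]_ : Config → List Trans → Config → Set where
    ε   : ∀ {c} → c ⟶*[ [] ] c
    _◅_ : ∀ {c c′ c″ t ts} → t ∈ T × c ⟶[ t ] c′ →
          c′ ⟶*[ ts ] c″ → c ⟶*[ t ∷ ts ] c″

  Reachable : Pred Config 0ℓ → Set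
  Reachable C-F = ∃₂ λ c c′ → Init c × C-F c′ × c ⟶* c′

  ReachableVia : List Trans → Pred Config 0ℓ → Set
  ReachableVia ts C-F = ∃₂ λ c c′ → Init c × C-F c′ × c ⟶*[ ts ] c′

------------------------------------------------------------------------
-- Symbolic representations

-- Finite subsets of 𝕊 are given by lists; such a set is empty precisely
-- when the list is [].
record SymbolicRepresentation (𝒫 : ParameterizedSystem)
                              (C-F : Pred (ParameterizedSystem.Config 𝒫) 0ℓ) : Set₁ where
  open ParameterizedSystem 𝒫

  infix 4 _⊑_ _⊑?_ _⊑⋆_
  infixl 6 _⊓_ _⊓⋆_

  field
    𝕊        : Set
    ⟦_⟧      : 𝕊 → Pred Config 0ℓ
    nonempty : ∀ e → ∃[ c ] ⟦ e ⟧ c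

  ⟦_⟧⋆ : List 𝕊 → Pred Config 0ℓ
  ⟦ E ⟧⋆ c = Any (λ e → ⟦ e ⟧ c) E

  field
    _⊑_     : Rel 𝕊 0ℓ
    _⊑?_    : Decidable _⊑_
    ⊑-refl  : Reflexive _⊑_
    ⊑-trans : Transitive _⊑_
    ⊑-sound : ∀ {e e′} → e ⊑ e′ → ⟦ e′ ⟧ ⊆′ ⟦ e ⟧

  _⊑⋆_ : Rel (List 𝕊) 0ℓ
  E ⊑⋆ E′ = All (λ e′ → Any (λ e → e ⊑ e′) E) E′

  field
    _⊓_    : 𝕊 → 𝕊 → List 𝕊
    ⊓-spec : ∀ e e′ → ⟦ e ⊓ e′ ⟧⋆ ≐ (⟦ e ⟧ ∩′ ⟦ e′ ⟧)

  _⊓⋆_ : List 𝕊 → List 𝕊 → List 𝕊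
  E ⊓⋆ E′ = concatMap (λ e → concatMap (λ e′ → e ⊓ e′) E′) E

  -- □ is the set of relaxation operators, presented as a family of maps
  -- on 𝕊; ∇ ⟨ e ⟩ is the value of the operator ∇ at e.
  field
    □       : Set
    _⟨_⟩    : □ → 𝕊 → 𝕊
    ∇-below : ∀ ∇ e → ∇ ⟨ e ⟩ ⊑ e
    ∇-mono  : ∀ ∇ {e e′} → e ⊑ e′ → ∇ ⟨ e ⟩ ⊑ ∇ ⟨ e′ ⟩
    ∇-wqo   : ∀ ∇ → ¬ ∃ λ (s : ℕ → 𝕊) → (∀ i → ∃[ e ] s i ≡ ∇ ⟨ e ⟩)
                                        × (∀ i j → i < j → ¬ (s i ⊑ s j))

  _⟨_⟩⋆ : □ → List 𝕊 → List 𝕊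
  ∇ ⟨ E ⟩⋆ = map (∇ ⟨_⟩) E

  _StrongerThan_ : Rel □ 0ℓ
  ∇′ StrongerThan ∇ = ∀ e → ∇ ⟨ e ⟩ ⊑ ∇′ ⟨ e ⟩

  field
    Ξ           : ∀ E E′ ∇ → E ⊓⋆ E′ ≡ [] → ∇ ⟨ E ⟩⋆ ⊓⋆ E′ ≢ [] → □
    Ξ-stronger  : ∀ E E′ ∇ p q → Ξ E E′ ∇ p q StrongerThan ∇
    Ξ-separates : ∀ E E′ ∇ p q → Ξ E E′ ∇ p q ⟨ E ⟩⋆ ⊓⋆ E′ ≡ []

    E-Init         : List 𝕊
    E-C-F          : List 𝕊
    E-Init-spec    : ⟦ E-Init ⟧⋆ ≐ Init
    E-C-F-spec     : ⟦ E-C-F ⟧⋆ ≐ C-F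
    E-Init-minimal : ∀ {e e′} → e ∈ E-Init → e′ ∈ E-Init → e ⊑ e′ → e ≡ e′

    -- The values of post and pre at transitions outside T are irrelevant.
    post      : Trans → 𝕊 → List 𝕊
    pre       : Trans → 𝕊 → List 𝕊
    post-spec : ∀ {t} → t ∈ T → ∀ e →
                ⟦ post t e ⟧⋆ ≐ (λ c′ → ∃[ c ] (c ⟶[ t ] c′ × ⟦ e ⟧ c))
    pre-spec  : ∀ {t} → t ∈ T → ∀ e →
                ⟦ pre t e ⟧⋆ ≐ (λ c′ → ∃[ c ] (c′ ⟶[ t ] c × ⟦ e ⟧ c))
    post-mono : ∀ {t} → t ∈ T → ∀ {e e′} → e ⊑ e′ → post t e ⊑⋆ post t e′
    pre-mono  : ∀ {t} → t ∈ T → ∀ {e e′} → e ⊑ e′ → pre t e ⊑⋆ pre t e′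

------------------------------------------------------------------------
-- Termination of a nondeterministic procedure whose single steps are
-- given by _⇒_ and whose halted states are those of the form halt r:
-- no execution gets stuck before halting (in particular, no operation
-- is called outside its domain), and no execution is infinite.

Terminates : {State Result : Set} → Rel State 0ℓ → (Result → State) → State → Set
Terminates {State} _⇒_ halt s =
  (∀ {s′} → Star _⇒_ s s′ → (∃[ r ] s′ ≡ halt r) ⊎ (∃[ s″ ] s′ ⇒ s″))
  × (¬ ∃ λ (f : ℕ → State) → f zero ≡ s × (∀ i → f i ⇒ f (suc i)))

------------------------------------------------------------------------
-- The algorithms

module Algorithms {𝒫 : ParameterizedSystem}
                  {C-F : Pred (ParameterizedSystem.Config 𝒫) 0ℓ}
                  (𝓡 : SymbolicRepresentation 𝒫 C-F) where
  open ParameterizedSystem 𝒫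
  open SymbolicRepresentation 𝓡

  -- e₀ · t₁ · e₁ ⋯ tₘ · eₘ, built from the left so that the final
  -- element is outermost.
  infixl 5 _·_·_
  data Trace : Set where
    start : 𝕊 → Trace
    _·_·_ : Trace → Trans → 𝕊 → Trace

  final : Trace → 𝕊
  final (start e)   = e
  final (τ · t · e) = e

  transitions : Trace → List Trans
  transitions (start e)   = []
  transitions (τ · t · e) = transitions τ ∷ʳ t

  Entry : Set
  Entry = 𝕊 × Trace

  data SearchResult : Set where
    unreachable : SearchResult
    trace       : Trace → SearchResult

  -- loop W V is the head of the while loop; expand τ A W V is inside the
  -- for loop for the removed pair with trace τ, where A holds the pairs
  -- (t , e) still to be processed.
  data SearchState : Set where
    loop   : (W V : List Entry) → SearchState
    expand : Trace → (A : List (Trans × 𝕊)) (W V : List Entry) → SearchState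
    return : SearchResult → SearchState

  successors : □ → 𝕊 → List (Trans × 𝕊)
  successors ∇ e = concatMap (λ t → map (t ,_) (∇ ⟨ post t e ⟩⋆)) T

  Covered : 𝕊 → List Entry → Set
  Covered e = Any (λ old → proj₁ old ⊑ e)

  prune : 𝕊 → List Entry → List Entry
  prune e = filter (λ old → ¬? (e ⊑? proj₁ old))

  -- The choice of the pair removed from W and the order of the for loop
  -- are left open.
  data _⊢_⇒₁_ (∇ : □) : SearchState → SearchState → Set where
    exhausted : ∀ {V} →
      ∇ ⊢ loop [] V ⇒₁ return unreachable
    hit : ∀ {e τ W V} → (e , τ) ∈ W → [ e ] ⊓⋆ E-C-F ≢ [] →
      ∇ ⊢ loop W V ⇒₁ return (trace τ)
    pick : ∀ {e τ W V} (w : (e , τ) ∈ W) → [ e ] ⊓⋆ E-C-F ≡ [] →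
      ∇ ⊢ loop W V ⇒₁ expand τ (successors ∇ e) (W ─ w) ((e , τ) ∷ V)
    skip : ∀ {τ t e A W V} (a : (t , e) ∈ A) → Covered e (W ++ V) →
      ∇ ⊢ expand τ A W V ⇒₁ expand τ (A ─ a) W V
    add : ∀ {τ t e A W V} (a : (t , e) ∈ A) → ¬ Covered e (W ++ V) →
      ∇ ⊢ expand τ A W V
        ⇒₁ expand τ (A ─ a) ((e , (τ · t · e)) ∷ prune e W) (prune e V)
    next : ∀ {τ W V} →
      ∇ ⊢ expand τ [] W V ⇒₁ loop W V

  search₀ : SearchState
  search₀ = loop (map (λ e → e , start e) E-Init) []

  Algorithm₁Returns : □ → SearchResult → Set
  Algorithm₁Returns ∇ r = Star (∇ ⊢_⇒₁_) search₀ (return r)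

  Algorithm₁Terminates : □ → Set
  Algorithm₁Terminates ∇ = Terminates (∇ ⊢_⇒₁_) return search₀

  data AnalysisResult : Set where
    reachable : Trace → AnalysisResult
    refined   : □ → AnalysisResult

  -- back σ Current: σ = e₀ · t₁ ⋯ tᵢ · eᵢ is the part of the input trace
  -- not yet traversed backwards.
  data AnalysisState : Set where
    back   : Trace → (Current : List 𝕊) → AnalysisState
    return : AnalysisResult → AnalysisState

  Pred⟨_,_,_⟩ : Trans → List 𝕊 → 𝕊 → List 𝕊
  Pred⟨ t , Current , e ⟩ = concatMap (pre t) Current ⊓⋆ [ e ]

  data _,_⊢_⇒₂_ (∇ : □) (τ : Trace) : AnalysisState → AnalysisState → Set where
    step : ∀ {σ t e Current} → Pred⟨ t , Current , final σ ⟩ ≢ [] →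
      ∇ , τ ⊢ back (σ · t · e) Current ⇒₂ back σ Pred⟨ t , Current , final σ ⟩
    refine : ∀ {σ t e Current} → Pred⟨ t , Current , final σ ⟩ ≡ [] →
      (p : post t (final σ) ⊓⋆ Current ≡ [])
      (q : ∇ ⟨ post t (final σ) ⟩⋆ ⊓⋆ Current ≢ []) →
      ∇ , τ ⊢ back (σ · t · e) Current
        ⇒₂ return (refined (Ξ (post t (final σ)) Current ∇ p q))
    reach : ∀ {e₀ Current} → Current ⊓⋆ E-Init ≢ [] →
      ∇ , τ ⊢ back (start e₀) Current ⇒₂ return (reachable τ)
    refine-init : ∀ {e₀ Current} → Current ⊓⋆ E-Init ≡ [] →
      (p : [ e₀ ] ⊓⋆ E-Init ≡ []) (q : ∇ ⟨ [ e₀ ] ⟩⋆ ⊓⋆ E-Init ≢ []) →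
      ∇ , τ ⊢ back (start e₀) Current
        ⇒₂ return (refined (Ξ [ e₀ ] E-Init ∇ p q))

  analysis₀ : Trace → AnalysisState
  analysis₀ τ = back τ ([ final τ ] ⊓⋆ E-C-F)

  Algorithm₂Returns : □ → Trace → AnalysisResult → Set
  Algorithm₂Returns ∇ τ r = Star (∇ , τ ⊢_⇒₂_) (analysis₀ τ) (return r)

  Algorithm₂Terminates : □ → Trace → Set
  Algorithm₂Terminates ∇ τ = Terminates (∇ , τ ⊢_⇒₂_) return (analysis₀ τ)

  data LoopResult : Set where
    unreachable : LoopResult
    reachable   : Trace → LoopResult

  -- iteration ∇ is the beginning of an iteration with current relaxation
  -- ∇; generated ∇ τ is the point in it where Algorithm 1 has returned τ.
  data LoopState : Set where
    iteration : □ → LoopState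
    generated : □ → Trace → LoopState
    return    : LoopResult → LoopState

  data _⇒_ : Rel LoopState 0ℓ where
    unreachable : ∀ {∇} → Algorithm₁Returns ∇ unreachable →
                  iteration ∇ ⇒ return unreachable
    generate    : ∀ {∇ τ} → Algorithm₁Returns ∇ (trace τ) →
                  iteration ∇ ⇒ generated ∇ τ
    reachable   : ∀ {∇ τ τ′} → Algorithm₂Returns ∇ τ (reachable τ′) →
                  generated ∇ τ ⇒ return (reachable τ′)
    refine      : ∀ {∇ τ ∇′} → Algorithm₂Returns ∇ τ (refined ∇′) →
                  generated ∇ τ ⇒ iteration ∇′

  IterationTerminates : □ → Set
  IterationTerminates ∇ =
    Algorithm₁Terminates ∇
    × (∀ τ → Algorithm₁Returns ∇ (trace τ) → Algorithm₂Terminates ∇ τ)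

-- Soundness of "unreachable" holds because the final V denotes an inductive
-- invariant, and Algorithm 1 terminates because the elements it adds would
-- otherwise form a bad sequence of relaxed elements.  Walking back along a trace,
-- Current is a nonempty set of configurations inside the current element that
-- reach C-F along the rest of the trace; a successful walk thus gives a run, and
-- a failed one at e_i leaves a Current contained in e_{i+1}.  The new relaxation,
-- and every stronger one, relaxes post(e_i) to a set disjoint from Current, so
-- e_{i+1} can never again follow e_i, and the trace is not generated a second time.

module Submission where

open import Defs
open import Data.Empty using (⊥; ⊥-elim)
open import Data.List.Base using (List; []; _∷_; _++_; [_]; concatMap; map; length)
open import Data.List.Membership.Propositional using (_∈_; find; lose)
open import Data.List.Membership.Propositional.Properties
  using (∈-map⁺; ∈-map⁻; ∈-concatMap⁺; ∈-concatMap⁻; ∈-filter⁺)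
open import Data.List.Properties using (++-assoc; ++-identityʳ; length-removeAt′)
open import Data.List.Relation.Unary.All as All using (All; []; _∷_)
import Data.List.Relation.Unary.All.Properties as All
open import Data.List.Relation.Unary.Any as Any using (Any; here; there; _─_; any?; index)
import Data.List.Relation.Unary.Any.Properties as Any
open import Data.Nat.Base using (ℕ; zero; suc; _≤_; _≤′_; ≤′-refl; ≤′-step; _<_; z≤n; s≤s)
open import Data.Nat.Induction using (<-wellFounded)
open import Data.Nat.Properties
  using (≤-refl; ≤-reflexive; ≤-trans; <⇒≤; ≤⇒≤′; m<1+n⇒m<n∨m≡n)
open import Data.Product.Base using (_×_; _,_; proj₁; proj₂; ∃; ∃-syntax)
open import Data.Product.Relation.Binary.Lex.Strict using (×-Lex; ×-wellFounded)
open import Data.Sum.Base using (_⊎_; inj₁; inj₂; [_,_]′)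
open import Data.Unit.Base using (⊤; tt)
open import Function.Base using (id; _∘_)
open import Induction.WellFounded using (Acc; acc)
open import Level using (0ℓ)
open import Relation.Binary.Construct.Closure.ReflexiveTransitive using (Star; fold)
open import Relation.Binary.Construct.Closure.Transitive
  using (TransClosure; _∷_) renaming ([_] to [_]⁺)
open import Relation.Binary.Core using (Rel)
open import Relation.Binary.PropositionalEquality.Core
  using (_≡_; _≢_; refl; sym; trans; cong; subst)
open import Relation.Nullary.Decidable.Core using (Dec; yes; no; ¬?)
open import Relation.Nullary.Negation.Core using (¬_)
open import Relation.Unary using (Pred; _⊆_)

-- Runs of a step relation, and removal of list elements

preserved : {S : Set} {_⟶_ : Rel S 0ℓ} (P : Pred S 0ℓ) →
            (∀ {s s′} → s ⟶ s′ → P s → P s′) →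
            ∀ {s s′} → Star _⟶_ s s′ → P s → P s′
preserved P pres = fold (λ s s′ → P s → P s′) (λ step rest → rest ∘ pres step) id

-- Well-founded descent cannot go on forever, so `P` must occur at `i` or later. Here `P` is either
-- an addition to the search or, to refute infinite runs outright, empty.
eventually : {A : Set} {_≺_ : Rel A 0ℓ} (f : ℕ → A) {P : Pred ℕ 0ℓ} →
             (∀ i → f (suc i) ≺ f i ⊎ P i) →
             ∀ i → Acc _≺_ (f i) → ∃[ k ] i ≤ k × P k
eventually f descend i (acc rs) with descend i
... | inj₂ p    = i , ≤-refl , p
... | inj₁ lt with eventually f descend (suc i) (rs lt)
...   | k , i<k , p = k , <⇒≤ i<k , p

module _ {A : Set} where

  ─-complement : ∀ {P : Pred A 0ℓ} {x xs} (w : x ∈ xs) → Any P xs → P x ⊎ Any P (xs ─ w)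
  ─-complement (here refl) (here p)  = inj₁ p
  ─-complement (here refl) (there a) = inj₂ a
  ─-complement (there w)   (here p)  = inj₂ (here p)
  ─-complement (there w)   (there a) with ─-complement w a
  ... | inj₁ p  = inj₁ p
  ... | inj₂ a′ = inj₂ (there a′)

  length-─-< : ∀ {x : A} {xs} (w : x ∈ xs) → length (xs ─ w) < length xs
  length-─-< {xs = xs} w = ≤-reflexive (sym (length-removeAt′ xs (index w)))

  ≡[]? : (xs : List A) → Dec (xs ≡ [])
  ≡[]? []      = yes refl
  ≡[]? (_ ∷ _) = no λ ()

  Any⇒≢[] : ∀ {P : Pred A 0ℓ} {xs} → Any P xs → xs ≢ []
  Any⇒≢[] (here _)  ()
  Any⇒≢[] (there _) ()

module _ {𝒫 : ParameterizedSystem} {C-F : Pred (ParameterizedSystem.Config 𝒫) 0ℓ}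
         (𝓡 : SymbolicRepresentation 𝒫 C-F) where
  open ParameterizedSystem 𝒫
  open SymbolicRepresentation 𝓡
  open Algorithms 𝓡

  -- Emptiness and meets of finite symbolic sets

  ⟦⟧⋆-inhabited : ∀ {E} → E ≢ [] → ∃[ c ] ⟦ E ⟧⋆ c
  ⟦⟧⋆-inhabited {[]}    E≢[] = ⊥-elim (E≢[] refl)
  ⟦⟧⋆-inhabited {e ∷ E} _    = proj₁ (nonempty e) , here (proj₂ (nonempty e))

  -- Each element denotes some configuration. This turns semantic disjointness into the equation
  -- `≡ []` that `Ξ` takes as a precondition.
  ⟦⟧⋆-empty : ∀ {E} → (∀ {c} → ¬ ⟦ E ⟧⋆ c) → E ≡ []
  ⟦⟧⋆-empty {[]}    _     = refl
  ⟦⟧⋆-empty {e ∷ E} empty = ⊥-elim (empty (here (proj₂ (nonempty e))))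

  ⊓⋆⁺ : ∀ E E′ {c} → ⟦ E ⟧⋆ c → ⟦ E′ ⟧⋆ c → ⟦ E ⊓⋆ E′ ⟧⋆ c
  ⊓⋆⁺ E E′ p p′ = Any.concatMap⁺ (λ e → concatMap (e ⊓_) E′)
    (Any.map (λ {e} q → Any.concatMap⁺ (e ⊓_)
      (Any.map (λ {e′} q′ → proj₂ (⊓-spec e e′) (q , q′)) p′)) p)

  ⊓⋆⁻ : ∀ E E′ {c} → ⟦ E ⊓⋆ E′ ⟧⋆ c → ⟦ E ⟧⋆ c × ⟦ E′ ⟧⋆ c
  ⊓⋆⁻ E E′ p with find (Any.concatMap⁻ (λ e → concatMap (e ⊓_) E′) {xs = E} p)
  ... | e , e∈E , p₁ with find (Any.concatMap⁻ (e ⊓_) {xs = E′} p₁)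
  ...   | e′ , e′∈E′ , p₂ with proj₁ (⊓-spec e e′) p₂
  ...     | q , q′ = lose e∈E q , lose e′∈E′ q′

  ⊓⋆-overlap : ∀ E E′ {c} → ⟦ E ⟧⋆ c → ⟦ E′ ⟧⋆ c → E ⊓⋆ E′ ≢ []
  ⊓⋆-overlap E E′ p p′ = Any⇒≢[] (⊓⋆⁺ E E′ p p′)

  -- Strength of relaxations, traces and covering

  StrongerThan-refl : ∀ {∇} → ∇ StrongerThan ∇
  StrongerThan-refl e = ⊑-refl

  StrongerThan-trans : ∀ {∇ ∇′ ∇″} → ∇″ StrongerThan ∇′ → ∇′ StrongerThan ∇ → ∇″ StrongerThan ∇
  StrongerThan-trans p q e = ⊑-trans (q e) (p e)

  -- The relaxation is an index on raw sequences, so that one sequence can be tested against the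
  -- relaxations of different iterations.
  data IsTrace (∇ : □) : Trace → Set where
    start  : ∀ {e} → e ∈ E-Init → IsTrace ∇ (start e)
    extend : ∀ {τ t e} → IsTrace ∇ τ → t ∈ T → e ∈ ∇ ⟨ post t (final τ) ⟩⋆ →
             IsTrace ∇ (τ · t · e)

  successors⁺ : ∀ ∇ {e t e′} → t ∈ T → e′ ∈ ∇ ⟨ post t e ⟩⋆ → (t , e′) ∈ successors ∇ e
  successors⁺ ∇ t∈T e′∈ = ∈-concatMap⁺ _ (lose t∈T (∈-map⁺ _ e′∈))

  successors⁻ : ∀ ∇ {e t e′} → (t , e′) ∈ successors ∇ e → t ∈ T × e′ ∈ ∇ ⟨ post t e ⟩⋆
  successors⁻ ∇ {e} p with find (∈-concatMap⁻ (λ t → map (t ,_) (∇ ⟨ post t e ⟩⋆)) {xs = T} p)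
  ... | t , t∈T , q with ∈-map⁻ (t ,_) q
  ...   | e′ , e′∈ , refl = t∈T , e′∈

  -- Pruning removes only entries above `e`; by transitivity `e` covers whatever they covered.
  Covered-prune : ∀ {e e′} L → Covered e′ L → e ⊑ e′ ⊎ Covered e′ (prune e L)
  Covered-prune {e} L p with find p
  ... | old , old∈L , old⊑e′ with e ⊑? proj₁ old
  ...   | yes e⊑old = inj₁ (⊑-trans e⊑old old⊑e′)
  ...   | no  e⋢old = inj₂ (lose (∈-filter⁺ (λ o → ¬? (e ⊑? proj₁ o)) old∈L e⋢old) old⊑e′)

  Covered-add : ∀ {e e′ τ} W V → Covered e′ (W ++ V) →
                Covered e′ (((e , τ) ∷ prune e W) ++ prune e V)
  Covered-add W V p with Any.++⁻ W p
  ... | inj₁ q = [ here , there ∘ Any.++⁺ˡ ]′ (Covered-prune W q)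
  ... | inj₂ q = [ here , there ∘ Any.++⁺ʳ _ ]′ (Covered-prune V q)

  Covered-pick : ∀ {e′ x} W V (w : x ∈ W) → Covered e′ (W ++ V) → Covered e′ ((W ─ w) ++ x ∷ V)
  Covered-pick W V w p with Any.++⁻ W p
  ... | inj₂ q = Any.++⁺ʳ (W ─ w) (there q)
  ... | inj₁ q with ─-complement w q
  ...   | inj₁ r = Any.++⁺ʳ (W ─ w) (here r)
  ...   | inj₂ r = Any.++⁺ˡ r

  -- Correctness of Algorithm 1

  Genuine : □ → Entry → Set
  Genuine ∇ (e , τ) = e ≡ final τ × IsTrace ∇ τ

  Extends : □ → Trace → Trans × 𝕊 → Set
  Extends ∇ τ (t , e) = t ∈ T × e ∈ ∇ ⟨ post t (final τ) ⟩⋆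

  -- A holds the successors still to be processed, L = W ∪ V the known elements.
  Explored : □ → List (Trans × 𝕊) → (L V : List Entry) → Set
  Explored ∇ A L V = All (λ old →
    [ proj₁ old ] ⊓⋆ E-C-F ≡ [] ×
    (∀ {t e} → (t , e) ∈ successors ∇ (proj₁ old) → (t , e) ∈ A ⊎ Covered e L)) V

  Explored-map : ∀ {∇ A A′ L L′ V} → (∀ {e} → Covered e L → Covered e L′) →
                 (∀ {t e} → (t , e) ∈ A → (t , e) ∈ A′ ⊎ Covered e L′) →
                 Explored ∇ A L V → Explored ∇ A′ L′ V
  Explored-map f g = All.map λ (p , q) → p , λ m → [ g , inj₂ ∘ f ]′ (q m)

  InitCovered : List Entry → Set
  InitCovered L = All (λ e → Covered e L) E-Init

  -- At a returned state the invariant is the correctness claim for the result, so preservation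
  -- along a run is all that remains to be shown.
  SearchInv : □ → SearchState → Set
  SearchInv ∇ (loop W V) =
    All (Genuine ∇) W × InitCovered (W ++ V) × Explored ∇ [] (W ++ V) V
  SearchInv ∇ (expand τ A W V) =
    IsTrace ∇ τ × All (Extends ∇ τ) A ×
    All (Genuine ∇) W × InitCovered (W ++ V) × Explored ∇ A (W ++ V) V
  SearchInv ∇ (return unreachable) = ¬ Reachable C-F
  SearchInv ∇ (return (trace τ))   = IsTrace ∇ τ × [ final τ ] ⊓⋆ E-C-F ≢ []

  exhausted-unreachable : ∀ {∇} V → InitCovered V → Explored ∇ [] V V → ¬ Reachable C-F
  exhausted-unreachable {∇} V init expl (c , c′ , c∈Init , c′∈C-F , run) =
    safe (fold (λ c c′ → Denoted c → Denoted c′) (λ s rest → rest ∘ closed s) id run initially)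
    where
    Denoted : Config → Set
    Denoted c = Any (λ old → ⟦ proj₁ old ⟧ c) V

    covered : ∀ {e c} → Covered e V → ⟦ e ⟧ c → Denoted c
    covered p c∈e = Any.map (λ old⊑e → ⊑-sound old⊑e c∈e) p

    initially : Denoted c
    initially with find (proj₂ E-Init-spec c∈Init)
    ... | e , e∈ , c∈e = covered (All.lookup init e∈) c∈e

    closed : ∀ {c c′} → c ⟶ c′ → Denoted c → Denoted c′
    closed (t , t∈T , s) p with find p
    ... | old , old∈V , c∈old with find (proj₂ (post-spec t∈T (proj₁ old)) (_ , s , c∈old))
    ...   | e , e∈post , c′∈e
          with proj₂ (All.lookup expl old∈V) (successors⁺ ∇ t∈T (∈-map⁺ (∇ ⟨_⟩) e∈post))
    -- No pair is pending, so the relaxed successor is covered; relaxing only enlarges denotations,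
    -- so it still contains the new configuration.
    ...     | inj₂ q = covered q (⊑-sound (∇-below ∇ e) c′∈e)

    safe : ¬ Denoted c′
    safe p with find p
    ... | old , old∈V , c∈old =
      ⊓⋆-overlap [ proj₁ old ] E-C-F (here c∈old) (proj₂ E-C-F-spec c′∈C-F)
        (proj₁ (All.lookup expl old∈V))

  SearchInv-step : ∀ {∇ s s′} → ∇ ⊢ s ⇒₁ s′ → SearchInv ∇ s → SearchInv ∇ s′
  SearchInv-step exhausted (_ , init , expl) = exhausted-unreachable _ init expl
  SearchInv-step (hit w nz) (gen , _) with All.lookup gen w
  ... | refl , isτ = isτ , nz
  SearchInv-step {∇} (pick {W = W} {V} w z) (gen , init , expl) with All.lookup gen w
  ... | refl , isτ =
    isτ , All.tabulate (successors⁻ ∇) , All.─⁺ w gen ,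
    All.map (Covered-pick W V w) init ,
    -- The picked entry joins `V`: it failed the target test by `z`, and all its successors are now
    -- pending.
    (z , inj₁) ∷ Explored-map (Covered-pick W V w) (λ ()) expl
  SearchInv-step (skip a c) (isτ , ext , gen , init , expl) =
    isτ , All.─⁺ a ext , gen , init , Explored-map id processed expl
    where
    processed : ∀ {t e} → (t , e) ∈ _ → _
    processed m with ─-complement a m
    ... | inj₁ refl = inj₂ c
    ... | inj₂ m′   = inj₁ m′
  SearchInv-step (add {e = e} {W = W} {V} a _) (isτ , ext , gen , init , expl) with All.lookup ext a
  ... | t∈T , e∈ =
    isτ , All.─⁺ a ext ,
    (refl , extend isτ t∈T e∈) ∷ All.filter⁺ (λ o → ¬? (e ⊑? proj₁ o)) gen ,
    All.map (Covered-add W V) init ,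
    -- Pruned entries drop out of the claim about `V`, and the new entry covers what they covered.
    All.filter⁺ (λ o → ¬? (e ⊑? proj₁ o)) (Explored-map (Covered-add W V) processed expl)
    where
    processed : ∀ {t e} → (t , e) ∈ _ → _
    processed m with ─-complement a m
    ... | inj₁ refl = inj₂ (here ⊑-refl)
    ... | inj₂ m′   = inj₁ m′
  SearchInv-step next (_ , _ , inv) = inv

  SearchInv-search₀ : ∀ ∇ → SearchInv ∇ search₀
  SearchInv-search₀ ∇ =
    All.map⁺ (All.tabulate λ e∈ → refl , start e∈) ,
    All.tabulate (λ e∈ → Any.++⁺ˡ (Any.map⁺ (lose e∈ ⊑-refl))) ,
    []

  Algorithm₁-correct : ∀ {∇ r} → Algorithm₁Returns ∇ r → SearchInv ∇ (return r)
  Algorithm₁-correct {∇} run = preserved (SearchInv ∇) SearchInv-step run (SearchInv-search₀ ∇)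

  -- Termination of Algorithm 1

  search-progress : ∀ ∇ s → (∃[ r ] s ≡ return r) ⊎ (∃[ s′ ] ∇ ⊢ s ⇒₁ s′)
  search-progress ∇ (loop [] V) = inj₂ (_ , exhausted)
  search-progress ∇ (loop ((e , τ) ∷ W) V) with ≡[]? ([ e ] ⊓⋆ E-C-F)
  ... | yes z = inj₂ (_ , pick (here refl) z)
  ... | no nz = inj₂ (_ , hit (here refl) nz)
  search-progress ∇ (expand τ [] W V) = inj₂ (_ , next)
  search-progress ∇ (expand τ ((t , e) ∷ A) W V) with any? (λ o → proj₁ o ⊑? e) (W ++ V)
  ... | yes c = inj₂ (_ , skip (here refl) c)
  ... | no ¬c = inj₂ (_ , add (here refl) ¬c)
  search-progress ∇ (return r) = inj₁ (r , refl)

  -- The value at returned states is trivial so that every step preserves the predicate.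
  Known : 𝕊 → SearchState → Set
  Known e (loop W V)       = Covered e (W ++ V)
  Known e (expand τ A W V) = Covered e (W ++ V)
  Known e (return r)       = ⊤

  Known-step : ∀ {∇ e s s′} → ∇ ⊢ s ⇒₁ s′ → Known e s → Known e s′
  Known-step exhausted               k = tt
  Known-step (hit _ _)               k = tt
  Known-step (pick {W = W} {V} w _)  k = Covered-pick W V w k
  Known-step (skip _ _)              k = k
  Known-step (add {W = W} {V} _ _)   k = Covered-add W V k
  Known-step next                    k = k

  Known-mono : ∀ {e e′} s → e ⊑ e′ → Known e s → Known e′ s
  Known-mono (loop W V)       e⊑e′ = Any.map λ p → ⊑-trans p e⊑e′
  Known-mono (expand τ A W V) e⊑e′ = Any.map λ p → ⊑-trans p e⊑e′
  Known-mono (return r)       e⊑e′ = id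

  -- A pick shortens `W`; a skip shortens `A`. The offsets 0, 1 and 2 make leaving the for loop and
  -- returning strict decreases as well.
  measure : SearchState → ℕ × ℕ
  measure (loop W V)       = length W , 1
  measure (expand τ A W V) = length W , suc (suc (length A))
  measure (return r)       = 0 , 0

  _≺_ : Rel (ℕ × ℕ) 0ℓ
  _≺_ = ×-Lex _≡_ _<_ _<_

  Fresh : □ → (s s′ : SearchState) → Set
  Fresh ∇ s s′ = ∃[ e ] (∃[ e₀ ] e ≡ ∇ ⟨ e₀ ⟩) × ¬ Known e s × Known e s′

  -- Only `add` can fail to decrease the measure. Its element is relaxed because pending pairs are
  -- relaxed successors, and it is not covered before the step but covers itself afterwards.
  progress-or-fresh : ∀ {∇ s s′} → SearchInv ∇ s → ∇ ⊢ s ⇒₁ s′ →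
                      measure s′ ≺ measure s ⊎ Fresh ∇ s s′
  progress-or-fresh inv exhausted             = inj₁ (inj₂ (refl , s≤s z≤n))
  progress-or-fresh inv (hit (here refl) _)   = inj₁ (inj₁ (s≤s z≤n))
  progress-or-fresh inv (hit (there _) _)     = inj₁ (inj₁ (s≤s z≤n))
  progress-or-fresh inv (pick w _)            = inj₁ (inj₁ (length-─-< w))
  progress-or-fresh inv (skip a _)            = inj₁ (inj₂ (refl , s≤s (s≤s (length-─-< a))))
  progress-or-fresh inv next                  = inj₁ (inj₂ (refl , s≤s (s≤s z≤n)))
  progress-or-fresh {∇} (_ , ext , _) (add a ¬c) with ∈-map⁻ (∇ ⟨_⟩) (proj₂ (All.lookup ext a))
  ... | e₀ , _ , e≡ = inj₂ (_ , (e₀ , e≡) , ¬c , here ⊑-refl)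

  -- An added element stays covered by W ∪ V, so no later addition lies above it.
  search-no-infinite-run : ∀ ∇ → ¬ ∃ λ (f : ℕ → SearchState) →
    f zero ≡ search₀ × (∀ i → ∇ ⊢ f i ⇒₁ f (suc i))
  search-no-infinite-run ∇ (f , f₀ , run) = ∇-wqo ∇ (added , (λ i → proj₁ (proj₂ (fresh i))) , bad)
    where
    inv : ∀ i → SearchInv ∇ (f i)
    inv zero    = subst (SearchInv ∇) (sym f₀) (SearchInv-search₀ ∇)
    inv (suc i) = SearchInv-step (run i) (inv i)

    nextAddition : ∀ i → ∃[ k ] i ≤ k × Fresh ∇ (f k) (f (suc k))
    nextAddition i = eventually (measure ∘ f) (λ i → progress-or-fresh (inv i) (run i)) i
      (×-wellFounded <-wellFounded <-wellFounded (measure (f i)))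

    addition : ℕ → ∃[ k ] Fresh ∇ (f k) (f (suc k))
    addition zero with nextAddition zero
    ... | k , _ , fr = k , fr
    -- Searching from one past the previous addition makes the positions strictly increasing.
    addition (suc i) with nextAddition (suc (proj₁ (addition i)))
    ... | k , _ , fr = k , fr

    position : ℕ → ℕ
    position i = proj₁ (addition i)

    fresh : ∀ i → Fresh ∇ (f (position i)) (f (suc (position i)))
    fresh i = proj₂ (addition i)

    added : ℕ → 𝕊
    added i = proj₁ (fresh i)

    position-suc : ∀ i → position i < position (suc i)
    position-suc i with nextAddition (suc (position i))
    ... | k , i<k , _ = i<k

    position-mono : ∀ i j → i < j → position i < position j
    position-mono i (suc j) i<1+j with m<1+n⇒m<n∨m≡n i<1+j
    ... | inj₁ i<j  = ≤-trans (position-mono i j i<j) (<⇒≤ (position-suc j))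
    ... | inj₂ refl = position-suc i

    known-later : ∀ {e} i j → i ≤ j → Known e (f i) → Known e (f j)
    known-later i j i≤j known = go (≤⇒≤′ i≤j)
      where
      go : ∀ {j} → i ≤′ j → Known _ (f j)
      go ≤′-refl     = known
      go (≤′-step p) = Known-step (run _) (go p)

    bad : ∀ i j → i < j → ¬ (added i ⊑ added j)
    bad i j i<j le with fresh i | fresh j
    ... | _ , _ , _ , known | _ , _ , unknown , _ =
      unknown (Known-mono (f (position j)) le
        -- The element is known only after its own step, hence `suc`; strict growth of positions is
        -- exactly the bound needed here.
        (known-later (suc (position i)) (position j) (position-mono i j i<j) known))

  Algorithm₁-terminates : ∀ ∇ → Algorithm₁Terminates ∇
  Algorithm₁-terminates ∇ = (λ _ → search-progress ∇ _) , search-no-infinite-run ∇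

  -- Algorithm 2

  -- `ts` is the part of the trace already walked back. The prefix clause and the exclusion for
  -- refined results range over all relaxations concerned, because the exclusion must persist in
  -- later iterations.
  AnalysisInv : □ → Trace → AnalysisState → Set
  AnalysisInv ∇ τ (back σ Current) =
    Current ≢ [] × ⟦ Current ⟧⋆ ⊆ ⟦ final σ ⟧ ×
    (∀ ∇′ → IsTrace ∇′ τ → IsTrace ∇′ σ) ×
    ∃ λ ts → transitions τ ≡ transitions σ ++ ts ×
             (∀ {c} → ⟦ Current ⟧⋆ c → ∃[ c′ ] C-F c′ × c ⟶*[ ts ] c′)
  AnalysisInv ∇ τ (return (reachable τ′)) = ReachableVia (transitions τ′) C-F
  AnalysisInv ∇ τ (return (refined ∇′))   =
    ∇′ StrongerThan ∇ × (∀ ∇″ → ∇″ StrongerThan ∇′ → ¬ IsTrace ∇″ τ)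

  Pred⁻ : ∀ {t} Current {e c} → t ∈ T → ⟦ Pred⟨ t , Current , e ⟩ ⟧⋆ c →
          ⟦ e ⟧ c × ∃[ c′ ] c ⟶[ t ] c′ × ⟦ Current ⟧⋆ c′
  Pred⁻ {t} Current {e} t∈T p with ⊓⋆⁻ (concatMap (pre t) Current) [ e ] p
  ... | q , here c∈e with find (Any.concatMap⁻ (pre t) {xs = Current} q)
  ...   | e′ , e′∈ , r with proj₁ (pre-spec t∈T e′) r
  ...     | c′ , s , c′∈e′ = c∈e , c′ , s , lose e′∈ c′∈e′

  Pred⁺ : ∀ {t} Current {e c c′} → t ∈ T → ⟦ e ⟧ c → c ⟶[ t ] c′ → ⟦ Current ⟧⋆ c′ →
          ⟦ Pred⟨ t , Current , e ⟩ ⟧⋆ c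
  Pred⁺ {t} Current {e} t∈T c∈e s p = ⊓⋆⁺ (concatMap (pre t) Current) [ e ]
    (Any.concatMap⁺ (pre t) (Any.map (λ {e′} c′∈e′ → proj₂ (pre-spec t∈T e′) (_ , s , c′∈e′)) p))
    (here c∈e)

  -- A common configuration would have a predecessor in `e`, and that predecessor would lie in the
  -- set assumed empty.
  post-disjoint : ∀ {t} Current {e} → t ∈ T → Pred⟨ t , Current , e ⟩ ≡ [] → post t e ⊓⋆ Current ≡ []
  post-disjoint {t} Current {e} t∈T z = ⟦⟧⋆-empty λ p →
    let p₁ , p₂ = ⊓⋆⁻ (post t e) Current p
        c , s , c∈e = proj₁ (post-spec t∈T e) p₁
    in Any⇒≢[] (Pred⁺ Current t∈T c∈e s p₂) z

  -- `e` relaxes some `e₀` in `E`, and the weaker `∇` sends `e₀` to a larger denotation, which thus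
  -- contains `Current`. With `∇′` equal to `∇` this is the second precondition of `Ξ`; with `∇` the
  -- output of `Ξ` it contradicts separation.
  relaxation-overlaps : ∀ {∇ ∇′ E Current e} → ∇′ StrongerThan ∇ → e ∈ ∇′ ⟨ E ⟩⋆ →
                        Current ≢ [] → ⟦ Current ⟧⋆ ⊆ ⟦ e ⟧ → ∇ ⟨ E ⟩⋆ ⊓⋆ Current ≢ []
  relaxation-overlaps {∇} {∇′} {E} {Current} stronger e∈ nz sub
    with ∈-map⁻ (∇′ ⟨_⟩) e∈ | ⟦⟧⋆-inhabited nz
  ... | e₀ , e₀∈E , refl | c , c∈ =
    ⊓⋆-overlap (∇ ⟨ E ⟩⋆) Current
      (lose (∈-map⁺ (∇ ⟨_⟩) e₀∈E) (⊑-sound (stronger e₀) (sub c∈))) c∈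

  -- All of `Current` lies in an element of `E-Init`, so a backward walk that gets as far as `e₀`
  -- has found a real run.
  start-overlaps-Init : ∀ {∇ e₀ Current} → IsTrace ∇ (start e₀) → Current ≢ [] →
                        ⟦ Current ⟧⋆ ⊆ ⟦ e₀ ⟧ → Current ⊓⋆ E-Init ≢ []
  start-overlaps-Init {Current = Current} (start e₀∈) nz sub with ⟦⟧⋆-inhabited nz
  ... | c , c∈ = ⊓⋆-overlap Current E-Init c∈ (lose e₀∈ (sub c∈))

  AnalysisInv-step : ∀ {∇ τ s s′} → IsTrace ∇ τ → ∇ , τ ⊢ s ⇒₂ s′ →
                     AnalysisInv ∇ τ s → AnalysisInv ∇ τ s′
  AnalysisInv-step {∇} isτ (step {σ} {t} {Current = Current} nz′) (nz , sub , prefix , ts , eq , via)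
    with prefix ∇ isτ
  ... | extend _ t∈T _ =
    nz′ , (λ c∈ → proj₁ (Pred⁻ Current t∈T c∈)) ,
    (λ ∇′ is → case-prefix (prefix ∇′ is)) ,
    t ∷ ts , trans eq (++-assoc (transitions σ) [ t ] ts) ,
    λ c∈ → let _ , c′ , s , c′∈ = Pred⁻ Current t∈T c∈
               c″ , c″∈C-F , run = via c′∈
           in c″ , c″∈C-F , ((t∈T , s) ◅ run)
    where
    case-prefix : ∀ {∇′ σ t e} → IsTrace ∇′ (σ · t · e) → IsTrace ∇′ σ
    case-prefix (extend is _ _) = is
  AnalysisInv-step {∇} isτ (refine {σ} {t} {e} {Current} _ p q) (nz , sub , prefix , _) =
    Ξ-stronger (post t (final σ)) Current ∇ p q , λ ∇″ stronger is → separated ∇″ stronger (prefix ∇″ is)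
    where
    separated : ∀ ∇″ → ∇″ StrongerThan Ξ (post t (final σ)) Current ∇ p q →
                ¬ IsTrace ∇″ (σ · t · e)
    separated ∇″ stronger (extend _ _ e∈) =
      relaxation-overlaps stronger e∈ nz sub (Ξ-separates (post t (final σ)) Current ∇ p q)
  AnalysisInv-step isτ (reach {Current = Current} nz) (_ , _ , _ , ts , eq , via) with ⟦⟧⋆-inhabited nz
  ... | c , c∈ with ⊓⋆⁻ Current E-Init c∈
  ...   | c∈Current , c∈Init with via c∈Current
  ...     | c′ , c′∈C-F , run =
    c , c′ , proj₁ E-Init-spec c∈Init , c′∈C-F , subst (λ ts → c ⟶*[ ts ] c′) (sym eq) run
  AnalysisInv-step {∇} isτ (refine-init z p q) (nz , sub , prefix , _) =
    ⊥-elim (start-overlaps-Init (prefix ∇ isτ) nz sub z)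

  AnalysisInv-analysis₀ : ∀ ∇ τ → [ final τ ] ⊓⋆ E-C-F ≢ [] → AnalysisInv ∇ τ (analysis₀ τ)
  AnalysisInv-analysis₀ ∇ τ nz =
    nz , (λ c∈ → Any.singleton⁻ (proj₁ (⊓⋆⁻ [ final τ ] E-C-F c∈))) , (λ _ → id) ,
    [] , sym (++-identityʳ (transitions τ)) ,
    λ c∈ → _ , proj₁ E-C-F-spec (proj₂ (⊓⋆⁻ [ final τ ] E-C-F c∈)) , ε

  Algorithm₂-correct : ∀ {∇ τ r} → SearchInv ∇ (return (trace τ)) → Algorithm₂Returns ∇ τ r →
                       AnalysisInv ∇ τ (return r)
  Algorithm₂-correct {∇} {τ} (isτ , nz) run =
    preserved (AnalysisInv ∇ τ) (AnalysisInv-step isτ) run (AnalysisInv-analysis₀ ∇ τ nz)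

  analysis-progress : ∀ {∇ τ} s → IsTrace ∇ τ → AnalysisInv ∇ τ s →
                      (∃[ r ] s ≡ return r) ⊎ (∃[ s′ ] ∇ , τ ⊢ s ⇒₂ s′)
  analysis-progress (return r) _ _ = inj₁ (r , refl)
  analysis-progress {∇} (back (start e₀) Current) isτ (nz , sub , prefix , _) =
    inj₂ (_ , reach (start-overlaps-Init (prefix ∇ isτ) nz sub))
  analysis-progress {∇} (back (σ · t · e) Current) isτ (nz , sub , prefix , _)
    with ≡[]? Pred⟨ t , Current , final σ ⟩ | prefix ∇ isτ
  ... | no nz′ | _                 = inj₂ (_ , step nz′)
  ... | yes z  | extend _ t∈T e∈ = inj₂ (_ , refine z (post-disjoint Current t∈T z)
                                     (relaxation-overlaps (StrongerThan-refl {∇}) e∈ nz sub))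

  -- A bare `start` still has one step to go, the one that returns; hence the value 1.
  height : AnalysisState → ℕ
  height (back (start _) _)   = 1
  height (back (σ · _ · _) C) = suc (height (back σ C))
  height (return _)           = 0

  height-back : ∀ σ C C′ → height (back σ C) ≡ height (back σ C′)
  height-back (start _)   C C′ = refl
  height-back (σ · _ · _) C C′ = cong suc (height-back σ C C′)

  height-step : ∀ {∇ τ s s′} → ∇ , τ ⊢ s ⇒₂ s′ → height s′ < height s
  height-step (step {σ} _)        = s≤s (≤-reflexive (height-back σ _ _))
  height-step (refine _ _ _)      = s≤s z≤n
  height-step (reach _)           = s≤s z≤n
  height-step (refine-init _ _ _) = s≤s z≤n

  Algorithm₂-terminates : ∀ {∇ τ} → SearchInv ∇ (return (trace τ)) → Algorithm₂Terminates ∇ τ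
  Algorithm₂-terminates {∇} {τ} (isτ , nz) =
    (λ run → analysis-progress _ isτ
       (preserved (AnalysisInv ∇ τ) (AnalysisInv-step isτ) run (AnalysisInv-analysis₀ ∇ τ nz))) ,
    -- Heights decrease at every step, so `eventually` with empty `P` refutes an infinite run.
    λ (f , _ , run) → proj₂ (proj₂ (eventually (height ∘ f) {P = λ _ → ⊥}
       (inj₁ ∘ height-step ∘ run) 0 (<-wellFounded _)))

  -- The refinement loop

  LoopInv : LoopState → Set
  LoopInv (iteration ∇)          = ⊤
  LoopInv (generated ∇ τ)        = SearchInv ∇ (return (trace τ))
  LoopInv (return unreachable)   = ¬ Reachable C-F
  LoopInv (return (reachable τ)) = ReachableVia (transitions τ) C-F

  LoopInv-step : ∀ {s s′} → s ⇒ s′ → LoopInv s → LoopInv s′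
  LoopInv-step (unreachable run) _   = Algorithm₁-correct run
  LoopInv-step (generate run)    _   = Algorithm₁-correct run
  LoopInv-step (reachable run)   inv = Algorithm₂-correct inv run
  LoopInv-step (refine run)      _   = tt

  LoopInv-run : ∀ {∇ s} → Star _⇒_ (iteration ∇) s → LoopInv s
  LoopInv-run run = preserved LoopInv LoopInv-step run tt

  -- `∇₀` is a fixed earlier relaxation. The search invariant is carried along because the guarantee
  -- that refinement strengthens depends on it.
  Refines : □ → LoopState → Set
  Refines ∇₀ (iteration ∇)   = ∇ StrongerThan ∇₀
  Refines ∇₀ (generated ∇ τ) = ∇ StrongerThan ∇₀ × SearchInv ∇ (return (trace τ))
  Refines ∇₀ (return r)      = ⊤

  Refines-step : ∀ {∇₀ s s′} → s ⇒ s′ → Refines ∇₀ s → Refines ∇₀ s′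
  Refines-step (unreachable _) _        = tt
  Refines-step (generate run)  stronger = stronger , Algorithm₁-correct run
  Refines-step (reachable _)   _        = tt
  Refines-step {∇₀} (refine {∇} {∇′ = ∇′} run) (stronger , inv) =
    StrongerThan-trans {∇₀} {∇} {∇′} (proj₁ (Algorithm₂-correct inv run)) stronger

  Refines-run : ∀ {∇₀ s s′} → TransClosure _⇒_ s s′ → Refines ∇₀ s → Refines ∇₀ s′
  Refines-run [ s ]⁺    = Refines-step s
  Refines-run (s ∷ run) = Refines-run run ∘ Refines-step s

  -- Nothing follows a returned state, so the first step is a refinement. Its output excludes `τ`
  -- for every stronger relaxation, and all later relaxations are stronger.
  no-trace-twice : ∀ {∇ τ ∇′ τ′} → SearchInv ∇ (return (trace τ)) →
                   TransClosure _⇒_ (generated ∇ τ) (generated ∇′ τ′) → τ ≢ τ′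
  no-trace-twice inv (reachable _ ∷ [ () ]⁺)
  no-trace-twice inv (reachable _ ∷ (() ∷ _))
  no-trace-twice inv (refine {∇′ = ∇₁} alg₂ ∷ run) refl
    with Algorithm₂-correct inv alg₂ | Refines-run {∇₁} run (StrongerThan-refl {∇₁})
  ... | _ , excluded | stronger , isτ , _ = excluded _ stronger isτ

theorem1 : (𝒫 : ParameterizedSystem) → let open ParameterizedSystem 𝒫 in
    (C-F : Pred Config 0ℓ) (𝓡 : SymbolicRepresentation 𝒫 C-F) →
    let open SymbolicRepresentation 𝓡
        open Algorithms 𝓡 in
    (∇₀ : □) →
      (∀ ∇ → Star _⇒_ (iteration ∇₀) (iteration ∇) → IterationTerminates ∇)
      × (Star _⇒_ (iteration ∇₀) (return unreachable) → ¬ Reachable C-F)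
      × (∀ τ → Star _⇒_ (iteration ∇₀) (return (reachable τ)) →
           ReachableVia (transitions τ) C-F)
      × (∀ ∇ τ ∇′ τ′ →
           Star _⇒_ (iteration ∇₀) (generated ∇ τ) →
           TransClosure _⇒_ (generated ∇ τ) (generated ∇′ τ′) →
           τ ≢ τ′)
theorem1 𝒫 C-F 𝓡 ∇₀ =
  (λ ∇ _ → Algorithm₁-terminates 𝓡 ∇ ,
           λ τ run → Algorithm₂-terminates 𝓡 (Algorithm₁-correct 𝓡 run)) ,
  LoopInv-run 𝓡 ,
  (λ τ → LoopInv-run 𝓡) ,
  λ ∇ τ ∇′ τ′ run → no-trace-twice 𝓡 (LoopInv-run 𝓡 run)
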